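{- Let $H$ be a digraph (possibly with loops) and let $D$ be an $H$-colored $3$-quasi-transitive digraph. For every $k \geq 5$, $D$ has a $(k,H)$-kernel.
   Context: All digraphs are finite. A digraph $D$ is $3$-quasi-transitive if for all distinct $u,v\in V(D)$, whenever there is a directed $uv$-path of length $3$, $u$ and $v$ are joined by an arc (in some direction). $D$ has no loops and comes with a map $\rho: A(D)\to V(H)$. For a walk $W=(x_0,\ldots,x_n)$ in $D$, there is an obstruction on $x_i$ if $(\rho(x_{i-1},x_i),\rho(x_i,x_{i+1})) \notin A(H)$; for an open walk this is considered at internal vertices $x_i$, $1\le i\le n-1$, for a closed walk at all $i\in\{0,\ldots,n-1\}$ with indices modulo $n$. $O_H(W)$ is the set of indices with an obstruction; the $H$-length is $l_H(W)=|O_H(W)|+1$ for open $W$ and $|O_H(W)|$ for closed $W$. A $(k,H)$-kernel ($k\ge2$) is a set $S\subseteq V(D)$ such that for every two distinct $u,v\in S$ every directed $uv$-path in $D$ has $H$-length at least $k$, and for every $x\in V(D)\setminus S$ there is a directed path from $x$ to a vertex of $S$ of $H$-length at most $k-1$. -}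

module Defs where

open import Data.Bool using (Bool; T; not; if_then_else_)
open import Data.Fin using (Fin; _≟_)
open import Data.Fin.Subset using (Subset; _∈_; _∉_; ∣_∣)
open import Data.List using (List; []; _∷_)
open import Data.List.Relation.Unary.Unique.Propositional using (Unique)
open import Data.Nat using (ℕ; zero; suc; _≤_; _∸_)
open import Data.Product using (Σ-syntax; ∃-syntax; _×_)
open import Data.Sum using (_⊎_)
open import Data.Vec using ([]; _∷_)
open import Relation.Binary.Construct.Closure.ReflexiveTransitive using (Star; ε; _◅_)
open import Relation.Binary.PropositionalEquality using (_≡_; _≢_)
open import Relation.Nullary using (¬_; does)

-- The Boolean adjacency matrix makes `Arc u v` a proposition: there are no
-- parallel arcs, so a function on arcs is a function on ordered pairs.
record Digraph : Set where
  field
    order : ℕ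
    adj   : Fin order → Fin order → Bool

  V : Set
  V = Fin order

  Arc : V → V → Set
  Arc u v = T (adj u v)

  Walk : V → V → Set
  Walk = Star Arc

  length : ∀ {u v} → Walk u v → ℕ
  length ε       = zero
  length (_ ◅ w) = suc (length w)

  vertices : ∀ {u v} → Walk u v → List V
  vertices {u} ε       = u ∷ []
  vertices {u} (_ ◅ w) = u ∷ vertices w

  IsPath : ∀ {u v} → Walk u v → Set
  IsPath w = Unique (vertices w)

open Digraph using (V; Arc)

Loopless : Digraph → Set
Loopless D = ∀ v → ¬ Arc D v v

3-QuasiTransitive : Digraph → Set
3-QuasiTransitive D =
  ∀ {u v} → u ≢ v → (w : Walk u v) → IsPath w → length w ≡ 3 → Arc D u v ⊎ Arc D v u
  where open Digraph D using (Walk; IsPath; length)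

ArcColouring : Digraph → Digraph → Set
ArcColouring H D = ∀ {u v} → Arc D u v → V H

module _ (H D : Digraph) (ρ : ArcColouring H D) where
  open Digraph D using (order; Walk; IsPath; length)

  -- The obstructions at every vertex of a walk except its last one, when the
  -- walk is entered by an arc of colour c.
  obstructionsAfter : V H → ∀ {u v} (w : Walk u v) → Subset (length w)
  obstructionsAfter c ε       = []
  obstructionsAfter c (a ◅ w) = not (Digraph.adj H c (ρ a)) ∷ obstructionsAfter (ρ a) w

  -- The colour of the last arc of a walk, or c if the walk has no arc.
  lastColour : V H → ∀ {u v} → Walk u v → V H
  lastColour c ε       = c
  lastColour c (a ◅ w) = lastColour (ρ a) w

  -- For a walk (x₀, …, xₙ) with first arc a, position i stands for xᵢ₊₁,
  -- so exactly the internal vertices x₁, …, xₙ₋₁ are considered.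
  openObstructions : ∀ {u x v} (a : Arc D u x) (w : Walk x v) → Subset (length w)
  openObstructions a w = obstructionsAfter (ρ a) w

  -- Here position i stands for xᵢ; the arc entering x₀ is the last one.
  closedObstructions : ∀ {u x v} (a : Arc D u x) (w : Walk x v) → Subset (suc (length w))
  closedObstructions a w = obstructionsAfter (lastColour (ρ a) w) (a ◅ w)

  H-length : ∀ {u v} → Walk u v → ℕ
  H-length         ε       = 0
  H-length {u} {v} (a ◅ w) =
    if does (u ≟ v) then ∣ closedObstructions a w ∣
                    else suc ∣ openObstructions a w ∣

  record IsKernel (k : ℕ) (S : Subset order) : Set where
    field
      independent : ∀ {u v} → u ∈ S → v ∈ S → u ≢ v →
                    (w : Walk u v) → IsPath w → k ≤ H-length w
      absorbent   : ∀ {x} → x ∉ S →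
                    ∃[ v ] v ∈ S × (Σ[ w ∈ Walk x v ] IsPath w × H-length w ≤ k ∸ 1)

{-# OPTIONS --safe #-}
module Submission where

-- Write d(u,v) for the distance in D.  Applying 3-quasi-transitivity along a
-- geodesic gives an arc v → u when d(u,v) is odd and at least 3, hence
-- d(v,u) ≤ 2 when d(u,v) is even and at least 6, and d(v,u) ≤ 4 when
-- d(u,v) = 4.  It follows that d(t,s) ≥ 5 forces the in-ball of radius 2 around
-- s to be strictly contained in the one around t.  So take for S, in each
-- terminal strong component, the vertex whose in-ball has the most elements (ties
-- broken by index): vertices of S do not reach one another, and every vertex
-- that reaches s ∈ S does so within distance 4 ≤ k ∸ 1.  The H-length of a walk
-- is at most its length, so this set is a (k,H)-kernel.

open import Defs
open import Data.Bool using (true; false)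
open import Data.Bool.Properties using (T?)
open import Data.Fin using (Fin; zero; suc; fromℕ<; combine; _≟_)
  renaming (_<_ to _<ᶠ_)
import Data.Fin.Induction as Fin
import Data.Fin.Properties as Fin
open import Data.Fin.Subset using (Subset; _∈_; _⊂_; ∣_∣)
open import Data.Fin.Subset.Properties using (∣p∣≤n; p⊂q⇒∣p∣<∣q∣)
open import Data.List using (List; []; _∷_; lookup)
import Data.List as List
import Data.List.Membership.DecPropositional as DecMembership
open import Data.List.Membership.Propositional using () renaming (_∈_ to _∈ˡ_)
open import Data.List.Membership.Propositional.Properties using (∈-lookup)
open import Data.List.Relation.Unary.All using ([]; _∷_)
import Data.List.Relation.Unary.All as All
open import Data.List.Relation.Unary.All.Properties using (¬Any⇒All¬)
open import Data.List.Relation.Unary.AllPairs using ([]; _∷_)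
open import Data.List.Relation.Unary.Any using (here; there)
open import Data.List.Relation.Unary.Unique.Propositional using (Unique)
open import Data.Nat using (ℕ; zero; suc; _+_; _*_; _∸_; _≤_; _<_; z≤n; s≤s; s≤s⁻¹; _≤?_)
open import Data.Nat.Induction using (<-rec)
open import Data.Nat.Properties
  using (≤-refl; ≤-trans; ≤-reflexive; n≤1+n; <⇒≱; ≰⇒>; ≮⇒≥; +-cancelˡ-≤;
         +-monoʳ-≤; +-cancelʳ-≤; ∸-monoˡ-≤; anyUpTo?)
open import Data.Product using (Σ-syntax; ∃-syntax; _×_; _,_; proj₁; proj₂)
open import Data.Sum using (_⊎_; inj₁; inj₂; swap)
open import Data.Vec using (tabulate)
open import Data.Vec.Properties using (lookup∘tabulate; lookup⇒[]=; []=⇒lookup)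
open import Function using (_∘_; flip)
open import Induction.WellFounded using (Acc; acc)
open import Relation.Binary using (IsStrictPartialOrder; tri<; tri≈; tri>)
import Relation.Binary as Binary
open import Relation.Binary.Construct.Closure.ReflexiveTransitive using (ε; _◅_)
open import Relation.Binary.PropositionalEquality
  using (_≡_; _≢_; refl; sym; trans; cong; subst₂; isEquivalence; resp₂)
open import Relation.Nullary using (¬_; Dec; yes; no; does; contradiction)
open import Relation.Nullary.Decidable using (_×-dec_; _→-dec_; ¬?; map′; dec-true; decidable-stable)
open import Relation.Unary using (Pred; Decidable)

-- Decidable subsets, lists without repetition, maximal elements

module _ {n} {p} {P : Pred (Fin n) p} (P? : Decidable P) where

  comprehension : Subset n
  comprehension = tabulate (does ∘ P?)

  ∈-comprehension⁺ : ∀ {x} → P x → x ∈ comprehension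
  ∈-comprehension⁺ {x} Px =
    lookup⇒[]= x _ (trans (lookup∘tabulate (does ∘ P?) x) (dec-true (P? x) Px))

  ∈-comprehension⁻ : ∀ {x} → x ∈ comprehension → P x
  ∈-comprehension⁻ {x} x∈
    with P? x | trans (sym (lookup∘tabulate (does ∘ P?) x)) ([]=⇒lookup x∈)
  ... | yes Px | _  = Px
  ... | no _   | ()

Unique⇒lookup-injective : ∀ {a} {A : Set a} {xs : List A} → Unique xs →
                          ∀ {i j} → lookup xs i ≡ lookup xs j → i ≡ j
Unique⇒lookup-injective (_ ∷ _)   {zero}  {zero}  _  = refl
Unique⇒lookup-injective (x∉ ∷ _)  {zero}  {suc j} eq = contradiction eq (All.lookup x∉ (∈-lookup j))
Unique⇒lookup-injective (x∉ ∷ _)  {suc i} {zero}  eq = contradiction (sym eq) (All.lookup x∉ (∈-lookup i))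
Unique⇒lookup-injective (_ ∷ xs!) {suc i} {suc j} eq = cong suc (Unique⇒lookup-injective xs! eq)

Unique⇒length≤ : ∀ {n} {xs : List (Fin n)} → Unique xs → List.length xs ≤ n
Unique⇒length≤ xs! = Fin.injective⇒≤ (Unique⇒lookup-injective xs!)

maximal-above : ∀ {n r} {_≺_ : Fin n → Fin n → Set r} → IsStrictPartialOrder _≡_ _≺_ →
                Binary.Decidable _≺_ →
                ∀ x → ∃[ v ] (x ≡ v ⊎ x ≺ v) × (∀ w → ¬ v ≺ w)
maximal-above {_≺_ = _≺_} spo _≺?_ x = go (Fin.spo-noetherian spo x)
  where
  go : ∀ {x} → Acc (flip _≺_) x → ∃[ v ] (x ≡ v ⊎ x ≺ v) × (∀ w → ¬ v ≺ w)
  go {x} (acc rs) with Fin.any? (x ≺?_)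
  ... | no  x⊀       = x , inj₁ refl , λ w x≺w → x⊀ (w , x≺w)
  ... | yes (w , x≺w) with go (rs x≺w)
  ...   | v , inj₁ refl , max = v , inj₂ x≺w , max
  ...   | v , inj₂ w≺v  , max = v , inj₂ (IsStrictPartialOrder.trans spo x≺w w≺v) , max

module _ (H D : Digraph) (ρ : ArcColouring H D) where
  open Digraph D using (Walk; length)

  -- A closed walk has one position for an obstruction per arc; an open walk has one fewer, which
  -- the added 1 makes up for.
  H-length≤length : ∀ {u v} (w : Walk u v) → H-length H D ρ w ≤ length w
  H-length≤length ε = z≤n
  H-length≤length {u} {v} (a ◅ w) with does (u ≟ v)
  ... | true  = ∣p∣≤n (closedObstructions H D ρ a w)
  ... | false = s≤s (∣p∣≤n (openObstructions H D ρ a w))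

-- Walks, paths and distances

module Walks (D : Digraph) where
  open Digraph D
  open DecMembership (_≟_ {order}) using () renaming (_∈?_ to _∈ˡ?_)

  infix 4 _⟶[_]_ _⟶[≤_]_ _⟶*_

  -- In this form existence is decidable by recursion on the length, and `++` adds lengths
  -- definitionally.
  _⟶[_]_ : V → ℕ → V → Set
  u ⟶[ zero ]  v = u ≡ v
  u ⟶[ suc n ] v = ∃[ x ] Arc u x × x ⟶[ n ] v

  _⟶[≤_]_ : V → ℕ → V → Set
  u ⟶[≤ n ] v = ∃[ m ] m < suc n × u ⟶[ m ] v

  _⟶*_ : V → V → Set
  u ⟶* v = ∃[ n ] u ⟶[ n ] v

  walk? : ∀ n u v → Dec (u ⟶[ n ] v)
  walk? zero    u v = u ≟ v
  walk? (suc n) u v = Fin.any? λ x → T? (adj u x) ×-dec walk? n x v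

  walk≤? : ∀ n u v → Dec (u ⟶[≤ n ] v)
  walk≤? n u v = anyUpTo? (λ m → walk? m u v) (suc n)

  infixr 5 _++_
  _++_ : ∀ {m n u v w} → u ⟶[ m ] v → v ⟶[ n ] w → u ⟶[ m + n ] w
  _++_ {zero}  refl        q = q
  _++_ {suc m} (x , a , p) q = x , a , p ++ q

  split : ∀ m {n u w} → u ⟶[ m + n ] w → ∃[ v ] u ⟶[ m ] v × v ⟶[ n ] w
  split zero    p           = _ , refl , p
  split (suc m) (x , a , p) with split m p
  ... | v , q , r = v , (x , a , q) , r

  arc⇒walk : ∀ {u v} → Arc u v → u ⟶[ 1 ] v
  arc⇒walk a = _ , a , refl

  walk⇒arc : ∀ {u v} → u ⟶[ 1 ] v → Arc u v
  walk⇒arc (_ , a , refl) = a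

  toSteps : ∀ {u v} (w : Walk u v) → u ⟶[ length w ] v
  toSteps ε       = refl
  toSteps (a ◅ w) = _ , a , toSteps w

  fromSteps : ∀ n {u v} → u ⟶[ n ] v → Σ[ w ∈ Walk u v ] length w ≡ n
  fromSteps zero    refl        = ε , refl
  fromSteps (suc n) (x , a , p) with fromSteps n p
  ... | w , refl = a ◅ w , refl

  Path≤ : ℕ → V → V → Set
  Path≤ n u v = Σ[ w ∈ Walk u v ] IsPath w × length w ≤ n

  suffixFrom : ∀ {u v x} (w : Walk u v) → IsPath w → x ∈ˡ vertices w → Path≤ (length w) x v
  suffixFrom ε       w!       (here refl) = ε , w! , ≤-refl
  suffixFrom (a ◅ w) w!       (here refl) = a ◅ w , w! , ≤-refl
  suffixFrom (a ◅ w) (_ ∷ w!) (there x∈) with suffixFrom w w! x∈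
  ... | p , p! , p≤ = p , p! , ≤-trans p≤ (n≤1+n _)

  -- Loop erasure: if the new first vertex already lies on the path built so far, that path is cut
  -- back to start there.
  toPath : ∀ {u v} (w : Walk u v) → Path≤ (length w) u v
  toPath ε           = ε , [] ∷ [] , z≤n
  toPath {u} (a ◅ w) with toPath w
  ... | p , p! , p≤ with u ∈ˡ? vertices p
  ...   | no  u∉ = a ◅ p , ¬Any⇒All¬ _ u∉ ∷ p! , s≤s p≤
  ...   | yes u∈ with suffixFrom p p! u∈
  ...     | q , q! , q≤ = q , q! , ≤-trans q≤ (≤-trans p≤ (n≤1+n _))

  walk≤⇒path : ∀ {n u v} → u ⟶[≤ n ] v → Path≤ n u v
  walk≤⇒path (m , m< , p) with fromSteps m p
  ... | w , refl with toPath w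
  ...   | q , q! , q≤ = q , q! , ≤-trans q≤ (s≤s⁻¹ m<)

  length-vertices : ∀ {u v} (w : Walk u v) → List.length (vertices w) ≡ suc (length w)
  length-vertices ε       = refl
  length-vertices (_ ◅ w) = cong suc (length-vertices w)

  reach? : ∀ u v → Dec (u ⟶* v)
  reach? u v = map′ (λ (n , _ , p) → n , p) shorten (walk≤? order u v)
    where
    shorten : u ⟶* v → u ⟶[≤ order ] v
    shorten (n , p) with walk≤⇒path (n , ≤-refl , p)
    -- The vertices of a path are distinct, so its length is below `order` and the bounded search is
    -- exhaustive.
    ... | w , w! , _ = length w , ≤-trans (≤-reflexive (sym (length-vertices w)))
                                    (≤-trans (Unique⇒length≤ w!) (n≤1+n _)) , toSteps w

  reach-refl : ∀ {u} → u ⟶* u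
  reach-refl = 0 , refl

  reach-trans : ∀ {u v w} → u ⟶* v → v ⟶* w → u ⟶* w
  reach-trans (m , p) (n , q) = m + n , p ++ q

  record Distance (n : ℕ) (u v : V) : Set where
    field
      walk     : u ⟶[ n ] v
      shortest : ∀ {m} → u ⟶[ m ] v → n ≤ m

  open Distance public

  distance : ∀ n {u v} → u ⟶[ n ] v → ∃[ m ] m ≤ n × Distance m u v
  distance = <-rec _ λ n rec {u} {v} p → shorter n rec p (anyUpTo? (λ m → walk? m u v) n)
    where
    shorter : ∀ n → (∀ {m} → m < n → ∀ {u v} → u ⟶[ m ] v → ∃[ l ] l ≤ m × Distance l u v) →
              ∀ {u v} → u ⟶[ n ] v → Dec (∃[ m ] m < n × u ⟶[ m ] v) →
              ∃[ m ] m ≤ n × Distance m u v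
    shorter n rec p (yes (m , m<n , q)) with rec m<n q
    ... | l , l≤m , d = l , ≤-trans l≤m (≤-trans (n≤1+n m) m<n) , d
    shorter n rec p (no ∄) = n , ≤-refl , record
      { walk = p ; shortest = λ {m} q → ≮⇒≥ λ m<n → ∄ (m , m<n , q) }

  -- A shorter replacement of one segment would shorten the whole geodesic; likewise for `suffix`.
  prefix : ∀ m {n u x v} → Distance (m + n) u v → u ⟶[ m ] x → x ⟶[ n ] v → Distance m u x
  prefix m {n} d p q = record
    { walk = p ; shortest = λ r → +-cancelʳ-≤ n m _ (shortest d (r ++ q)) }

  suffix : ∀ m {n u x v} → Distance (m + n) u v → u ⟶[ m ] x → x ⟶[ n ] v → Distance n x v
  suffix m {n} d p q = record
    { walk = q ; shortest = λ r → +-cancelˡ-≤ m n _ (shortest d (p ++ r)) }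

-- Short walks back along a geodesic

module QuasiTransitive (D : Digraph) (loopless : Loopless D) (qt : 3-QuasiTransitive D) where
  open Digraph D
  open Walks D

  arc⇒≢ : ∀ {u v} → Arc u v → u ≢ v
  arc⇒≢ a refl = loopless _ a

  -- A walk of length 3 with distinct ends that is not a path contains the arc
  -- from its first vertex to its last.
  adjacent : ∀ {u v} → u ≢ v → u ⟶[ 3 ] v → Arc u v ⊎ Arc v u
  adjacent {u} {v} u≢v (x , a , y , b , .v , c , refl) with u ≟ y | x ≟ v
  ... | yes refl | _        = inj₁ c
  ... | no _     | yes refl = inj₁ a
  ... | no u≢y   | no x≢v   = qt u≢v (a ◅ b ◅ c ◅ ε)
    ((arc⇒≢ a ∷ u≢y ∷ u≢v ∷ []) ∷ (arc⇒≢ b ∷ x≢v ∷ []) ∷ (arc⇒≢ c ∷ []) ∷ [] ∷ []) refl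

  distinct : ∀ {n u v} → Distance (suc n) u v → u ≢ v
  distinct d u≡v = contradiction (shortest d {0} u≡v) λ ()

  backward : ∀ {n u v} → Distance (2 + n) u v → Arc u v ⊎ Arc v u → Arc v u
  backward d (inj₁ a) = contradiction (shortest d (arc⇒walk a)) λ { (s≤s ()) }
  backward d (inj₂ a) = a

  -- Let x and y be the vertices at distances 2 and 3 from u on the geodesic. Induction gives v → x
  -- and the base case y → u, so v → x → y → u has length 3 and its distinct ends are adjacent; an
  -- arc u → v would be too short.
  odd⇒arc : ∀ k {u v} → Distance (3 + k * 2) u v → Arc v u
  odd⇒arc zero    d = backward d (adjacent (distinct d) (walk d))
  odd⇒arc (suc k) {u} {v} d
    with split 3 (walk d)
  ... | y , p , q with split 2 p
  ...   | x , r , s = backward d (swap (adjacent (distinct d ∘ sym) (arc⇒walk vx ++ s ++ arc⇒walk yu)))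
    where
    vx : Arc v x
    vx = odd⇒arc k (suffix 2 d r (s ++ q))
    yu : Arc y u
    yu = odd⇒arc 0 (prefix 3 d p q)

  -- Cutting after 3 arcs leaves two geodesics of odd length at least 3, each with an arc back.
  even⇒walk : ∀ k {u v} → Distance (6 + k * 2) u v → v ⟶[ 2 ] u
  even⇒walk k d with split 3 (walk d)
  ... | x , p , q = _ , odd⇒arc k (suffix 3 d p q) , _ , odd⇒arc 0 (prefix 3 d p q) , refl

  -- The first three and the last three arcs overlap in the middle two; these join the two arcs
  -- back.
  four⇒walk : ∀ {u v} → Distance 4 u v → v ⟶[ 4 ] u
  four⇒walk d with walk d
  ... | x , a , p with split 2 p
  ...   | y , q , r =
    arc⇒walk (odd⇒arc 0 (suffix 1 d (arc⇒walk a) p))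
      ++ q ++ arc⇒walk (odd⇒arc 0 (prefix 3 d (arc⇒walk a ++ q) r))

  -- 4 stands apart because, unlike the larger even numbers, it is not a sum of two odd numbers that
  -- are at least 3.
  data Shape : ℕ → Set where
    short : ∀ {n} → n < 3 → Shape n
    four  : Shape 4
    odd   : ∀ k → Shape (3 + k * 2)
    even  : ∀ k → Shape (6 + k * 2)

  shape-step : ∀ {n} → 3 ≤ n → Shape n → Shape (2 + n)
  shape-step 3≤n (short n<3) = contradiction n<3 (<⇒≱ (s≤s 3≤n))
  shape-step _   four        = even 0
  shape-step _   (odd k)     = odd (suc k)
  shape-step _   (even k)    = even (suc k)

  shape : ∀ n → Shape n
  shape 0 = short (s≤s z≤n)
  shape 1 = short (s≤s (s≤s z≤n))
  shape 2 = short (s≤s (s≤s (s≤s z≤n)))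
  shape 3 = odd 0
  shape 4 = four
  shape (suc (suc n@(suc (suc (suc _))))) = shape-step (s≤s (s≤s (s≤s z≤n))) (shape n)

  -- In-balls of vertices at distance at least 5

  far⇒back : ∀ {n u v} → 5 ≤ n → Distance n u v → v ⟶[≤ 2 ] u
  far⇒back {n} 5≤n d with shape n
  ... | short n<3 = contradiction (≤-trans n<3 (s≤s (s≤s (s≤s z≤n)))) (<⇒≱ (s≤s 5≤n))
  ... | four      = contradiction 5≤n (<⇒≱ ≤-refl)
  ... | odd k     = 1 , s≤s (s≤s z≤n) , arc⇒walk (odd⇒arc k d)
  ... | even k    = 2 , ≤-refl , even⇒walk k d

  -- If d(y,t) > 2, parity leaves only d(y,t) = d(t,y) = 4, so d(t,s) is 5 or 6;
  -- either way the arcs of odd⇒arc lead from y to t in at most two steps.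
  ball-grows : ∀ {n s t} → 5 ≤ n → Distance n t s → ∀ {y} → y ⟶[≤ 2 ] s → y ⟶[≤ 2 ] t
  ball-grows {n} {s} {t} 5≤n d {y} (i , s≤s i≤2 , p) = from-y (distance _ (p ++ proj₂ (proj₂ s⟶t)))
    where
    s⟶t : s ⟶[≤ 2 ] t
    s⟶t = far⇒back 5≤n d

    t⟶y-long : ∀ {j} → t ⟶[ j ] y → 3 ≤ j
    -- 5 ≤ d(t,s) ≤ j + i with i ≤ 2.
    t⟶y-long {j} q = +-cancelʳ-≤ 2 3 j
      (≤-trans 5≤n (≤-trans (shortest d (q ++ p)) (+-monoʳ-≤ j i≤2)))

    near : Arc y t → y ⟶[≤ 2 ] t
    near a = 1 , s≤s (s≤s z≤n) , arc⇒walk a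

    from-t-4 : ∀ {n} i → 5 ≤ n → Distance n t s → y ⟶[ i ] s → n ≤ 4 + i → i ≤ 2 →
               t ⟶[ 4 ] y → y ⟶[≤ 2 ] t
    from-t-4 0 5≤n d p n≤ _ q = contradiction n≤ (<⇒≱ 5≤n)
    -- Here d(t,s) = 5, so s → t; the index 1 of `odd⇒arc` stands for distance 5.
    from-t-4 1 (s≤s (s≤s (s≤s (s≤s (s≤s z≤n))))) d p
      (s≤s (s≤s (s≤s (s≤s (s≤s z≤n))))) _ q = 2 , ≤-refl , p ++ arc⇒walk (odd⇒arc 1 d)
    -- Again d(t,s) = 5, and y reaches t in three steps through s.
    from-t-4 2 (s≤s (s≤s (s≤s (s≤s (s≤s z≤n))))) d p
      (s≤s (s≤s (s≤s (s≤s (s≤s z≤n))))) _ q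
      with adjacent (λ { refl → contradiction (t⟶y-long {0} refl) λ () }) (p ++ arc⇒walk (odd⇒arc 1 d))
    ... | inj₁ a = near a
    ... | inj₂ a = contradiction (t⟶y-long (arc⇒walk a)) λ { (s≤s ()) }
    -- Now d(t,s) = 6, so the middle vertex x between y and s has d(t,x) = 5, whence x → t.
    from-t-4 2 (s≤s (s≤s (s≤s (s≤s (s≤s z≤n))))) d (x , a , p)
      (s≤s (s≤s (s≤s (s≤s (s≤s (s≤s z≤n)))))) _ q =
      2 , ≤-refl , arc⇒walk a ++ arc⇒walk (odd⇒arc 1 (prefix 5 d (q ++ arc⇒walk a) p))
    from-t-4 (suc (suc (suc _))) _ _ _ _ (s≤s (s≤s ())) _

    from-t : ∀ {j} → 3 ≤ j → j ≤ 4 → Distance j t y → y ⟶[≤ 2 ] t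
    from-t (s≤s (s≤s (s≤s z≤n))) (s≤s (s≤s (s≤s z≤n))) e = near (odd⇒arc 0 e)
    from-t (s≤s (s≤s (s≤s z≤n))) (s≤s (s≤s (s≤s (s≤s z≤n)))) e =
      from-t-4 i 5≤n d p (shortest d (walk e ++ p)) i≤2 (walk e)

    from-y : ∃[ m ] m ≤ i + proj₁ s⟶t × Distance m y t → y ⟶[≤ 2 ] t
    from-y (m , _ , e) with shape m
    ... | short m<3 = m , m<3 , walk e
    ... | odd k     = contradiction (t⟶y-long (arc⇒walk (odd⇒arc k e))) λ { (s≤s ()) }
    ... | even k    = contradiction (t⟶y-long (even⇒walk k e)) λ { (s≤s (s≤s ())) }
    ... | four      =
      let _ , j≤4 , e′ = distance 4 (four⇒walk e)
      in from-t (t⟶y-long (walk e′)) j≤4 e′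

  in-ball : V → Subset order
  in-ball x = comprehension λ y → walk≤? 2 y x

  in-ball-grows : ∀ {n s t} → 5 ≤ n → Distance n t s → in-ball s ⊂ in-ball t
  in-ball-grows {s = s} {t} 5≤n d =
    (λ y∈ → ∈-comprehension⁺ (λ y → walk≤? 2 y t)
              (ball-grows 5≤n d (∈-comprehension⁻ (λ y → walk≤? 2 y s) y∈))) ,
    -- The inclusion is strict because t lies in its own ball but too far from s.
    t , ∈-comprehension⁺ (λ y → walk≤? 2 y t) (0 , s≤s z≤n , refl) ,
    λ t∈ → let m , m<3 , p = ∈-comprehension⁻ (λ y → walk≤? 2 y s) t∈ in
      <⇒≱ 5≤n (≤-trans (shortest d p) (≤-trans (s≤s⁻¹ m<3) (s≤s (s≤s z≤n))))

  -- The order on vertices and its maximal elements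

  size : V → Fin (suc order)
  size v = fromℕ< (s≤s (∣p∣≤n (in-ball v)))

  -- `combine` is lexicographic: ball size decides, and the index of the vertex breaks ties.
  key : V → Fin (suc order * order)
  key v = combine (size v) v

  key-injective : ∀ {u v} → key u ≡ key v → u ≡ v
  key-injective {u} {v} = Fin.combine-injectiveʳ (size u) u (size v) v

  key-mono : ∀ {s t} → in-ball s ⊂ in-ball t → key s <ᶠ key t
  key-mono {s} {t} s⊂t = Fin.combine-monoˡ-< s t
    (subst₂ _<_ (sym (Fin.toℕ-fromℕ< _)) (sym (Fin.toℕ-fromℕ< _)) (p⊂q⇒∣p∣<∣q∣ s⊂t))

  infix 4 _≺_
  -- Leaving a strong component always counts as going up; inside one, the key must increase.
  _≺_ : V → V → Set
  u ≺ v = u ⟶* v × (v ⟶* u → key u <ᶠ key v)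

  ≺-isStrictPartialOrder : IsStrictPartialOrder _≡_ _≺_
  ≺-isStrictPartialOrder = record
    { isEquivalence = isEquivalence
    ; irrefl        = λ { refl (_ , lt) → Fin.<-irrefl refl (lt reach-refl) }
    ; trans         = λ (uv , lt) (vw , lt′) → reach-trans uv vw ,
        -- A return from w to u puts all three vertices in one component, so both key comparisons
        -- apply.
        λ wu → Fin.<-trans (lt (reach-trans vw wu)) (lt′ (reach-trans wu uv))
    ; <-resp-≈      = resp₂ _≺_
    }

  _≺?_ : Binary.Decidable _≺_
  u ≺? v = reach? u v ×-dec (reach? v u →-dec (key u Fin.<? key v))

  Maximal : V → Set
  Maximal v = ∀ w → ¬ v ≺ w

  maximal? : Decidable Maximal
  maximal? v = Fin.all? λ w → ¬? (v ≺? w)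

  -- Maximality of u forces v to reach back; in a common component, distinct keys would put one
  -- vertex below the other.
  maximal-unreachable : ∀ {u v} → Maximal u → Maximal v → u ⟶* v → u ≡ v
  maximal-unreachable {u} {v} u-max v-max uv = key-injective keys
    where
    vu : v ⟶* u
    vu = decidable-stable (reach? v u) λ ¬vu → u-max v (uv , λ vu → contradiction vu ¬vu)

    keys : key u ≡ key v
    keys with Fin.<-cmp (key u) (key v)
    ... | tri< lt _ _ = contradiction (uv , λ _ → lt) (u-max v)
    ... | tri≈ _ eq _ = eq
    ... | tri> _ _ gt = contradiction (vu , λ _ → gt) (v-max u)

  maximal-absorbs : ∀ x → ∃[ v ] Maximal v × x ⟶[≤ 4 ] v
  maximal-absorbs x with maximal-above ≺-isStrictPartialOrder _≺?_ x
  ... | v , inj₁ refl , max = v , max , 0 , s≤s z≤n , refl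
  ... | v , inj₂ ((_ , p) , _) , max with distance _ p
  ...   | m , _ , d with m ≤? 4
  ...     | yes m≤4 = v , max , m , s≤s m≤4 , walk d
  -- At distance at least 5, v reaches x back and x has the larger ball, so v ≺ x.
  ...     | no  m≰4 with far⇒back (≰⇒> m≰4) d
  ...       | l , _ , q = contradiction
    ((l , q) , λ _ → key-mono (in-ball-grows (≰⇒> m≰4) d)) (max x)

theorem19 : (H D : Digraph) → Loopless D → 3-QuasiTransitive D →
    (ρ : ArcColouring H D) → (k : ℕ) → 5 ≤ k →
    Σ[ S ∈ Subset (Digraph.order D) ] IsKernel H D ρ k S
theorem19 H D loopless qt ρ k 5≤k = comprehension maximal? , record
  -- Vacuous: no walk joins two distinct maximal vertices.
  { independent = λ u∈ v∈ u≢v w _ → contradiction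
      (maximal-unreachable (∈-comprehension⁻ maximal? u∈) (∈-comprehension⁻ maximal? v∈)
                           (_ , toSteps w))
      u≢v
  ; absorbent   = λ {x} _ →
      let v , max , x⟶v = maximal-absorbs x
          w , w! , w≤4  = walk≤⇒path x⟶v
      in v , ∈-comprehension⁺ maximal? max , w , w! ,
         ≤-trans (H-length≤length H D ρ w) (≤-trans w≤4 (∸-monoˡ-≤ 1 5≤k))
  }
  where
  open Walks D
  open QuasiTransitive D loopless qt
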